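{- Let $n\geq 2$ and let $c_0:V(K_n)\to\mathbb{Z}$ be any initial chip configuration on the complete graph $K_n$. Then the sequence of configurations $(c_t)_{t\ge0}$ produced by the diffusion process is eventually periodic, i.e. there exist $t\geq 0$ and $p\geq 1$ with $c_{t+p}=c_t$.
   Context: Diffusion process: for a finite simple graph $G$ and a chip configuration $c_t:V(G)\to\mathbb{Z}$ (negative values allowed), the next configuration is defined simultaneously for every vertex $u$ by $c_{t+1}(u)=c_t(u)-|\{w\in N(u): c_t(u)>c_t(w)\}|+|\{w\in N(u): c_t(u)<c_t(w)\}|$. -}

module Defs where

open import Data.Fin.Base using (Fin)
open import Data.Fin.Properties using (_≟_)
open import Data.Integer.Base using (ℤ; +_; _+_; _-_)
open import Data.Integer.Properties using (_<?_)
open import Data.List.Base using (List; allFin; filter; length)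
open import Data.Nat.Base using (ℕ; zero; suc)
open import Level using (0ℓ)
open import Relation.Binary.Core using (Rel)
open import Relation.Binary.Definitions using (Decidable; Irreflexive; Symmetric)
open import Relation.Binary.PropositionalEquality using (_≡_; _≢_; ≢-sym)
open import Relation.Nullary.Decidable using (¬?)

record SimpleGraph (n : ℕ) : Set₁ where
  field
    Adj    : Rel (Fin n) 0ℓ
    adj?   : Decidable Adj
    sym    : Symmetric Adj
    irrefl : Irreflexive _≡_ Adj

  N : Fin n → List (Fin n)
  N u = filter (adj? u) (allFin n)

K : (n : ℕ) → SimpleGraph n
K n = record
  { Adj    = _≢_
  ; adj?   = λ u w → ¬? (u ≟ w)
  ; sym    = ≢-sym
  ; irrefl = λ u≡w u≢w → u≢w u≡w
  }

Config : ℕ → Set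
Config n = Fin n → ℤ

module _ {n : ℕ} (G : SimpleGraph n) where
  open SimpleGraph G using (N)

  -- Neighbour lists have no repetitions, so the length of a filtered one is
  -- the cardinality of the corresponding set of neighbours.
  poorer : Config n → Fin n → ℕ
  poorer c u = length (filter (λ w → c w <? c u) (N u))

  richer : Config n → Fin n → ℕ
  richer c u = length (filter (λ w → c u <? c w) (N u))

  step : Config n → Config n
  step c u = c u - + poorer c u + + richer c u

  diffusion : Config n → ℕ → Config n
  diffusion c₀ zero    = c₀
  diffusion c₀ (suc t) = step (diffusion c₀ t)

{-# OPTIONS --safe #-}
-- On K n a vertex with more chips has at least as many poorer and at most as many
-- richer neighbours, so a step never widens an ordered pair's gap, except that the
-- pair may swap, and then the new gap is at most 2n.  Hence all gaps stay bounded.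
-- The total number of chips is conserved, so some vertex is always at most (and
-- some vertex at least) its initial value; with bounded gaps this confines the
-- configurations to a finite set, and two of them must coincide.
module Submission where

open import Defs
open import Data.Nat.Base using (ℕ; _+_; _≥_)
open import Data.Product.Base using (∃-syntax; _×_)
open import Relation.Binary.PropositionalEquality using (_≗_)

open import Algebra.Bundles using (AbelianGroup)
import Algebra.Properties.CommutativeMonoid.Sum
import Algebra.Properties.Group
open import Data.Fin.Base using (Fin; zero; suc; toℕ; fromℕ<; funToFin; finToFun)
open import Data.Fin.Properties using (finToFun-funToFin; fromℕ<-injective; pigeonhole)
open import Data.Integer.Base as ℤ using (ℤ; +_; 0ℤ; 1ℤ; -_; ∣_∣; +≤+)
import Data.Integer.Properties as ℤ
open import Data.Integer.Tactic.RingSolver using (solve-∀)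
open import Data.List.Base using ([]; _∷_; allFin; filter; length; tabulate)
open import Data.List.Properties using (length-filter; length-tabulate; filter-accept; filter-reject)
open import Data.List.Relation.Binary.Sublist.Propositional using (⊆-refl)
open import Data.List.Relation.Binary.Sublist.Propositional.Properties using (filter⁺; length-mono-≤)
open import Data.Nat.Base as ℕ using (zero; suc; _⊔_; z≤n; s≤s)
import Data.Nat.Properties as ℕ
open import Data.Product.Base using (_,_; ∃₂; proj₁; proj₂)
open import Data.Sum.Base using (inj₁; inj₂)
open import Function.Base using (_∘_; id)
open import Level using (Level)
open import Relation.Binary.PropositionalEquality
  using (_≡_; refl; sym; trans; cong; subst; module ≡-Reasoning)
open import Relation.Nullary using (Dec; yes; no)
open import Relation.Unary using (Pred; Decidable; _⊆_)

open Algebra.Properties.CommutativeMonoid.Sum ℤ.+-0-commutativeMonoid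
  using (sum; sum-cong-≗; ∑-distrib-+; ∑-comm)
open Algebra.Properties.Group (AbelianGroup.group ℤ.+-0-abelianGroup) using () renaming (∙-cancelʳ to +-cancelʳ)

private
  variable
    a p q : Level
    A : Set a
    n : ℕ

filter-filter : {P : Pred A p} {Q : Pred A q} (P? : Decidable P) (Q? : Decidable Q) →
  P ⊆ Q → ∀ xs → filter P? (filter Q? xs) ≡ filter P? xs
filter-filter P? Q? P⊆Q [] = refl
filter-filter P? Q? P⊆Q (x ∷ xs) with P? x
... | yes Px rewrite filter-accept Q? {xs = xs} (P⊆Q Px) =
  trans (filter-accept P? Px) (cong (x ∷_) (filter-filter P? Q? P⊆Q xs))
... | no ¬Px with Q? x
...   | yes _ = trans (filter-reject P? ¬Px) (filter-filter P? Q? P⊆Q xs)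
...   | no  _ = filter-filter P? Q? P⊆Q xs

indicator : Dec A → ℤ
indicator (yes _) = 1ℤ
indicator (no _)  = 0ℤ

-- Turns a count into a sum of zeros and ones, so that double counting becomes an interchange of two
-- finite sums.
length-filter-tabulate : {P : Pred A p} (P? : Decidable P) (f : Fin n → A) →
  + length (filter P? (tabulate f)) ≡ sum (λ i → indicator (P? (f i)))
length-filter-tabulate {n = zero}  P? f = refl
length-filter-tabulate {n = suc n} P? f with P? (f zero)
... | yes _ = cong (λ k → 1ℤ ℤ.+ k) (length-filter-tabulate P? (f ∘ suc))
... | no  _ = trans (length-filter-tabulate P? (f ∘ suc)) (sym (ℤ.+-identityˡ _))

sum-mono-≤ : {f g : Fin n → ℤ} → (∀ i → f i ℤ.≤ g i) → sum f ℤ.≤ sum g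
sum-mono-≤ {zero}  f≤g = ℤ.≤-refl
sum-mono-≤ {suc n} f≤g = ℤ.+-mono-≤ (f≤g zero) (sum-mono-≤ (f≤g ∘ suc))

-- The bare `Fin n` argument witnesses that the index set is nonempty; two empty sums would be
-- equal.
sum-mono-< : {f g : Fin n → ℤ} → Fin n → (∀ i → f i ℤ.< g i) → sum f ℤ.< sum g
sum-mono-< {suc n} _ f<g = ℤ.+-mono-<-≤ (f<g zero) (sum-mono-≤ (ℤ.<⇒≤ ∘ f<g ∘ suc))

bounded : (f : Fin n → ℕ) → ∃[ B ] ∀ i → f i ℕ.≤ B
bounded {zero}  f = 0 , λ ()
bounded {suc n} f with bounded (f ∘ suc)
... | B , f≤B = f zero ⊔ B , λ
  { zero    → ℕ.m≤m⊔n (f zero) B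
  ; (suc i) → ℕ.≤-trans (f≤B i) (ℕ.m≤n⊔m (f zero) B)
  }

Confined : ℕ → ℤ → Set
Confined R i = - + R ℤ.≤ i × i ℤ.≤ + R

∣i∣≤n⇒confined : ∀ {i m} → ∣ i ∣ ℕ.≤ m → Confined m i
∣i∣≤n⇒confined {+ _}        k≤m       = ℤ.neg-≤-pos , +≤+ k≤m
∣i∣≤n⇒confined {ℤ.-[1+ _ ]} (s≤s k≤m) = ℤ.-≤- k≤m , ℤ.-≤+

module _ (R : ℕ) where

  private
    shift : ∀ {i} → Confined R i → + ∣ i ℤ.+ + R ∣ ≡ i ℤ.+ + R
    shift {i} (-R≤i , _) = ℤ.0≤i⇒+∣i∣≡i
      (subst (ℤ._≤ i ℤ.+ + R) (ℤ.+-inverseˡ (+ R)) (ℤ.+-monoˡ-≤ (+ R) -R≤i))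

    shift< : ∀ {i} → Confined R i → ∣ i ℤ.+ + R ∣ ℕ.< suc (R + R)
    shift< c@(_ , i≤R) = s≤s (ℤ.drop‿+≤+
      (subst (ℤ._≤ + (R + R)) (sym (shift c)) (ℤ.+-monoˡ-≤ (+ R) i≤R)))

  -- Adding `R` moves the interval from `- R` to `R` onto the naturals up to `R + R`, hence
  -- `suc (R + R)` codes.
  encode : ∀ {i} → Confined R i → Fin (suc (R + R))
  encode c = fromℕ< (shift< c)

  encode-injective : ∀ {i j} (ci : Confined R i) (cj : Confined R j) →
    encode ci ≡ encode cj → i ≡ j
  encode-injective {i} {j} ci cj eq = +-cancelʳ (+ R) i j
    (trans (sym (shift ci)) (trans (cong +_ (fromℕ<-injective _ _ _ _ eq)) (shift cj)))

-- A confined configuration is coded vertex by vertex and packed into one of `suc (R + R) ^ n`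
-- numbers. Pigeonhole is applied to one more time than there are codes; unpacking equal codes at
-- each vertex gives the pointwise equality.
confined⇒recurrent : ∀ R (x : ℕ → Fin n → ℤ) → (∀ t u → Confined R (x t u)) →
  ∃₂ λ s t → s ℕ.< t × x s ≗ x t
confined⇒recurrent R x conf
  with pigeonhole (ℕ.n<1+n _) (λ i → funToFin (λ u → encode R (conf (toℕ i) u)))
... | i , j , i<j , eq = toℕ i , toℕ j , i<j , λ u → encode-injective R (conf (toℕ i) u) (conf (toℕ j) u)
  (trans (sym (finToFun-funToFin _ u)) (trans (cong (λ k → finToFun k u) eq) (finToFun-funToFin _ u)))

module _ (c : Config n) where

  -- A strict comparison already rules out `w ≡ u`, so the neighbour filter removes nothing further.
  -- The counts of all vertices now run over the same list, which makes them comparable.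
  poorer-K : ∀ u → poorer (K n) c u ≡ length (filter (λ w → c w ℤ.<? c u) (allFin n))
  poorer-K u = cong length (filter-filter _ _ (λ { cw<cu refl → ℤ.<-irrefl refl cw<cu }) (allFin n))

  richer-K : ∀ u → richer (K n) c u ≡ length (filter (λ w → c u ℤ.<? c w) (allFin n))
  richer-K u = cong length (filter-filter _ _ (λ { cu<cw refl → ℤ.<-irrefl refl cu<cw }) (allFin n))

  poorer-mono : ∀ {u v} → c u ℤ.≤ c v → poorer (K n) c u ℕ.≤ poorer (K n) c v
  poorer-mono {u} {v} cu≤cv rewrite poorer-K u | poorer-K v =
    length-mono-≤ (filter⁺ _ _ (λ { refl cw<cu → ℤ.<-≤-trans cw<cu cu≤cv }) (⊆-refl {x = allFin n}))

  richer-anti : ∀ {u v} → c u ℤ.≤ c v → richer (K n) c v ℕ.≤ richer (K n) c u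
  richer-anti {u} {v} cu≤cv rewrite richer-K u | richer-K v =
    length-mono-≤ (filter⁺ _ _ (λ { refl cv<cw → ℤ.≤-<-trans cu≤cv cv<cw }) (⊆-refl {x = allFin n}))

  poorer≤n : ∀ u → poorer (K n) c u ℕ.≤ n
  poorer≤n u rewrite poorer-K u =
    ℕ.≤-trans (length-filter (λ w → c w ℤ.<? c u) (allFin n)) (ℕ.≤-reflexive (length-tabulate {n = n} id))

  richer≤n : ∀ u → richer (K n) c u ℕ.≤ n
  richer≤n u rewrite richer-K u =
    ℕ.≤-trans (length-filter (λ w → c u ℤ.<? c w) (allFin n)) (ℕ.≤-reflexive (length-tabulate {n = n} id))

  -- Both sides count the ordered pairs (u , w) with c u < c w.
  sum-richer≡sum-poorer : sum (λ u → + richer (K n) c u) ≡ sum (λ u → + poorer (K n) c u)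
  sum-richer≡sum-poorer = begin
    sum (λ u → + richer (K n) c u)                     ≡⟨ sum-cong-≗ richer-sum ⟩
    sum (λ u → sum (λ w → indicator (c u ℤ.<? c w)))   ≡⟨ ∑-comm (λ u w → indicator (c u ℤ.<? c w)) ⟩
    sum (λ w → sum (λ u → indicator (c u ℤ.<? c w)))   ≡⟨ sum-cong-≗ poorer-sum ⟨
    sum (λ w → + poorer (K n) c w)                     ∎
    where
    open ≡-Reasoning
    richer-sum : ∀ u → + richer (K n) c u ≡ sum (λ w → indicator (c u ℤ.<? c w))
    richer-sum u = trans (cong +_ (richer-K u)) (length-filter-tabulate (λ w → c u ℤ.<? c w) id)
    poorer-sum : ∀ w → + poorer (K n) c w ≡ sum (λ u → indicator (c u ℤ.<? c w))
    poorer-sum w = trans (cong +_ (poorer-K w)) (length-filter-tabulate (λ u → c u ℤ.<? c w) id)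

  -- Adding the total loss `P` to both sides removes the subtraction inside `step`; what remains is
  -- that total gain equals total loss.
  sum-step : sum (step (K n) c) ≡ sum c
  sum-step = +-cancelʳ P _ _ (begin
    sum (step (K n) c) ℤ.+ P                        ≡⟨ ∑-distrib-+ (step (K n) c) _ ⟨
    sum (λ u → step (K n) c u ℤ.+ + poorer (K n) c u) ≡⟨ sum-cong-≗ (λ u → rearrange (c u) _ _) ⟩
    sum (λ u → c u ℤ.+ + richer (K n) c u)          ≡⟨ ∑-distrib-+ c _ ⟩
    sum c ℤ.+ sum (λ u → + richer (K n) c u)        ≡⟨ cong (λ k → sum c ℤ.+ k) sum-richer≡sum-poorer ⟩
    sum c ℤ.+ P                                     ∎)
    where
    open ≡-Reasoning
    P : ℤ
    P = sum (λ u → + poorer (K n) c u)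
    rearrange : ∀ x y z → x ℤ.- y ℤ.+ z ℤ.+ y ≡ x ℤ.+ z
    rearrange = solve-∀

  step-mono-gap : ∀ {D} → n + n ℕ.≤ D → (∀ u v → c u ℤ.≤ c v ℤ.+ + D) →
    ∀ u v → step (K n) c u ℤ.≤ step (K n) c v ℤ.+ + D
  step-mono-gap {D} 2n≤D gap u v with ℤ.≤-total (c v) (c u)
  -- `u` is at least as rich as `v`, so it loses at least as much and gains at most as much: the old
  -- bound on the gap survives.
  ... | inj₁ cv≤cu = subst (step (K n) c u ℤ.≤_) (rearrange (c v) _ _ (+ D))
    (ℤ.+-mono-≤ (ℤ.+-mono-≤ (gap u v) (ℤ.neg-mono-≤ (+≤+ (poorer-mono cv≤cu))))
                (+≤+ (richer-anti cv≤cu)))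
    where
    rearrange : ∀ x y z d → x ℤ.+ d ℤ.- y ℤ.+ z ≡ x ℤ.- y ℤ.+ z ℤ.+ d
    rearrange = solve-∀
  -- `u` may overtake `v`, but it starts no higher, rises by at most `n`, and `v` falls by at most
  -- `n`. This is where `2n≤D` enters.
  ... | inj₂ cu≤cv = begin
    step (K n) c u                       ≤⟨ ℤ.+-mono-≤ (ℤ.+-mono-≤ cu≤cv (ℤ.neg-mono-≤ (+≤+ z≤n)))
                                                       (+≤+ (richer≤n u)) ⟩
    c v ℤ.- 0ℤ ℤ.+ + n                   ≡⟨ rearrange (c v) (+ n) ⟩
    c v ℤ.- + n ℤ.+ 0ℤ ℤ.+ (+ n ℤ.+ + n) ≤⟨ ℤ.+-mono-≤ (ℤ.+-mono-≤ (ℤ.+-monoʳ-≤ (c v)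
                                              (ℤ.neg-mono-≤ (+≤+ (poorer≤n v)))) (+≤+ z≤n)) (+≤+ 2n≤D) ⟩
    step (K n) c v ℤ.+ + D               ∎
    where
    open ℤ.≤-Reasoning
    rearrange : ∀ x m → x ℤ.- 0ℤ ℤ.+ m ≡ x ℤ.- m ℤ.+ 0ℤ ℤ.+ (m ℤ.+ m)
    rearrange = solve-∀

-- If some `c u` exceeded `B + D`, the gap bound would put every `c v` above `B`, hence above
-- `c₀ v`, and the sums would differ. The lower bound is symmetric.
confined-of-sum≡ : ∀ {B D} {c₀ c : Config n} → (∀ u → Confined B (c₀ u)) →
  (∀ u v → c u ℤ.≤ c v ℤ.+ + D) → sum c ≡ sum c₀ → ∀ u → Confined (B + D) (c u)
confined-of-sum≡ {B = B} {D} {c₀} {c} conf gap eq u = ℤ.≮⇒≥ lower , ℤ.≮⇒≥ upper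
  where
  upper : + (B + D) ℤ.≮ c u
  upper B+D<cu = ℤ.<-irrefl (sym eq) (sum-mono-< u λ v →
    ℤ.≤-<-trans (proj₂ (conf v)) (+-cancelʳ-< (ℤ.<-≤-trans B+D<cu (gap u v))))
    where
    +-cancelʳ-< : ∀ {i j} → i ℤ.+ + D ℤ.< j ℤ.+ + D → i ℤ.< j
    +-cancelʳ-< lt = ℤ.≰⇒> (λ j≤i → ℤ.<⇒≱ lt (ℤ.+-monoˡ-≤ (+ D) j≤i))
  lower : c u ℤ.≮ - + (B + D)
  lower cu<-B-D = ℤ.<-irrefl eq (sum-mono-< u λ v → ℤ.<-≤-trans
    (ℤ.≤-<-trans (gap v u) (subst (c u ℤ.+ + D ℤ.<_) (rearrange (+ B) (+ D)) (ℤ.+-monoˡ-< (+ D) cu<-B-D)))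
    (proj₁ (conf v)))
    where
    rearrange : ∀ b d → - (b ℤ.+ d) ℤ.+ d ≡ - b
    rearrange = solve-∀

sum-diffusion : (c₀ : Config n) → ∀ t → sum (diffusion (K n) c₀ t) ≡ sum c₀
sum-diffusion c₀ zero    = refl
sum-diffusion c₀ (suc t) = trans (sum-step (diffusion _ c₀ t)) (sum-diffusion c₀ t)

diffusion-gap : ∀ {D} (c₀ : Config n) → n + n ℕ.≤ D → (∀ u v → c₀ u ℤ.≤ c₀ v ℤ.+ + D) →
  ∀ t u v → diffusion (K n) c₀ t u ℤ.≤ diffusion (K n) c₀ t v ℤ.+ + D
diffusion-gap c₀ 2n≤D gap zero    = gap
diffusion-gap c₀ 2n≤D gap (suc t) = step-mono-gap _ 2n≤D (diffusion-gap c₀ 2n≤D gap t)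

diffusion-confined : (c₀ : Config n) → ∃[ R ] ∀ t u → Confined R (diffusion (K n) c₀ t u)
diffusion-confined {n} c₀ with bounded (∣_∣ ∘ c₀)
... | B , ∣c₀∣≤B = B + D , λ t →
  confined-of-sum≡ conf (diffusion-gap c₀ (ℕ.m≤m+n (n + n) (B + B)) gap t) (sum-diffusion c₀ t)
  where
  -- The summand `n + n` is what preserving the gap bound under a step requires; `B + B` covers the
  -- initial gaps, as all values of `c₀` lie between `- B` and `B`.
  D : ℕ
  D = n + n + (B + B)
  conf : ∀ u → Confined B (c₀ u)
  conf u = ∣i∣≤n⇒confined (∣c₀∣≤B u)
  gap : ∀ u v → c₀ u ℤ.≤ c₀ v ℤ.+ + D
  gap u v = begin
    c₀ u                    ≤⟨ proj₂ (conf u) ⟩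
    + B                     ≡⟨ rearrange (+ B) ⟩
    - + B ℤ.+ + (B + B)     ≤⟨ ℤ.+-mono-≤ (proj₁ (conf v)) (+≤+ (ℕ.m≤n+m (B + B) (n + n))) ⟩
    c₀ v ℤ.+ + D            ∎
    where
    open ℤ.≤-Reasoning
    rearrange : ∀ b → b ≡ - b ℤ.+ (b ℤ.+ b)
    rearrange = solve-∀

theorem12 : (n : ℕ) → n ≥ 2 → (c₀ : Config n) →
    ∃[ t ] ∃[ p ] (p ≥ 1 × diffusion (K n) c₀ (t + p) ≗ diffusion (K n) c₀ t)
theorem12 n _ c₀ with diffusion-confined c₀
... | R , conf with confined⇒recurrent R (diffusion (K n) c₀) conf
... | s , t , s<t , cₛ≗cₜ = s , t ℕ.∸ s , ℕ.m<n⇒0<n∸m s<t , λ u →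
  trans (cong (λ k → diffusion (K n) c₀ k u) (ℕ.m+[n∸m]≡n (ℕ.<⇒≤ s<t))) (sym (cₛ≗cₜ u))
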